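{- Let $I=\{1,\dots,n\}$ be a finite set of items and $M=\{1,\dots,m\}$ a set of bins. Each item $i\in I$ has a rational size $s_i>0$, and each pair $(i,j)\in I\times M$ has a rational profit $p_{i,j}\ge 0$. For $S\subseteq I$ let $\phi(S)$ be the optimal value of the linear program $LP(S)$: maximize $\sum_{i\in I,\,j\in M} x_{i,j}p_{i,j}$ subject to $\sum_{j\in M}x_{i,j}\le 1$ for all $i\in I$; $\sum_{i\in I}x_{i,j}s_i\le 1$ for all $j\in M$; $x_{i,j}=0$ for all $i\in I\setminus S$, $j\in M$; and $x_{i,j}\ge 0$ for all $i\in I$, $j\in M$. Then $\phi:2^I\to\mathbb{R}_{\ge 0}$ is submodular, i.e., $\phi(S)+\phi(T)\ge \phi(S\cup T)+\phi(S\cap T)$ for all $S,T\subseteq I$.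
   Context: This is the LP relaxation of the generalized assignment problem with unit-capacity bins and bin-independent item sizes; $x_{i,j}$ is the fraction of item $i$ assigned to bin $j$. The paper assumes throughout that all numbers are rational. -}

module Defs where

open import Data.Nat using (ℕ; zero; suc)
open import Data.Fin using (Fin; zero; suc)
open import Data.Fin.Subset using (Subset; _∉_)
open import Data.Rational using (ℚ; 0ℚ; 1ℚ; _+_; _*_; _≤_)
open import Data.Product using (Σ; _×_)
open import Relation.Binary.PropositionalEquality using (_≡_)

sumFin : ∀ {K : ℕ} → (Fin K → ℚ) → ℚ
sumFin {zero}  f = 0ℚ
sumFin {suc K} f = f zero + sumFin {K} (λ k → f (suc k))

-- an assignment x : items → bins → ℚ   (x i j = fraction of item i in bin j)
Assignment : ℕ → ℕ → Set
Assignment n m = Fin n → Fin m → ℚ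

Feasible : ∀ {n m : ℕ} → (Fin n → ℚ) → Subset n → Assignment n m → Set
Feasible {n} {m} s S x =
  ((i : Fin n) → sumFin (λ (j : Fin m) → x i j) ≤ 1ℚ) ×
  ((j : Fin m) → sumFin (λ (i : Fin n) → x i j * s i) ≤ 1ℚ) ×
  ((i : Fin n) → (j : Fin m) → i ∉ S → x i j ≡ 0ℚ) ×
  ((i : Fin n) → (j : Fin m) → 0ℚ ≤ x i j)

value : ∀ {n m : ℕ} → (Fin n → Fin m → ℚ) → Assignment n m → ℚ
value {n} {m} p x = sumFin (λ (i : Fin n) → sumFin (λ (j : Fin m) → x i j * p i j))

IsOptimalValue : ∀ {n m : ℕ} → (Fin n → ℚ) → (Fin n → Fin m → ℚ) → Subset n → ℚ → Set
IsOptimalValue {n} {m} s p S v =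
  Σ (Assignment n m) (λ x → Feasible s S x × value p x ≡ v) ×
  ((x : Assignment n m) → Feasible s S x → value p x ≤ v)

{-# OPTIONS --safe #-}
-- Let x and y be optimal for S ∪ T and S ∩ T.  We redistribute x + y = u + v with u feasible for S
-- and v feasible for T.  Attach to every item i and every bin j a number q i, r j ∈ [0, 1] and put
--   u i j = (1 - q i) x i j + r j y i j,     v i j = q i x i j + (1 - r j) y i j.
-- If q i is the y-average of r over the bins of item i, and r j is the (size weighted) x-average of q
-- over the items of bin j, then every row and column sum of u and v is a convex combination of the
-- corresponding sums of x and y.  The supports are right when q = 1 on T ∖ S and q = 0 on S ∖ T.
-- So q and r form a harmonic function on a weighted graph with boundary values 0 and 1, which exists
-- by Gaussian elimination on a diagonally dominant system.
module Submission where

open import Defs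
open import Data.Nat using (ℕ)
open import Data.Fin using (Fin)
open import Data.Fin.Subset using (Subset; _∪_; _∩_)
open import Data.Rational using (ℚ; 0ℚ; _+_; _≤_; _<_)

open import Algebra.Bundles using (CommutativeRing)
open import Data.Nat using (zero; suc)
open import Data.Fin using (zero; suc)
open import Data.Fin.Subset using (_∈_; _∉_)
open import Data.Fin.Subset.Properties using (_∈?_; x∈p∩q⁻; x∈p∪q⁻)
open import Data.Product using (Σ; _×_; _,_; proj₁; proj₂)
open import Data.Rational using (1ℚ; _*_; _-_; -_; 1/_; _≤?_; nonNegative; positive)
open import Data.Rational.Properties
open import Data.Rational.Solver using (module +-*-Solver)
open import Data.Sum using (_⊎_; inj₁; inj₂; [_,_]′)
open import Relation.Binary.PropositionalEquality using (_≡_; refl; sym; trans; cong; cong₂; subst; subst₂; module ≡-Reasoning)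
open import Relation.Nullary using (yes; no; contradiction)
open import Algebra.Properties.Semiring.Sum (CommutativeRing.semiring +-*-commutativeRing)
  using (sum; sum-cong-≗; ∑-distrib-+; ∑-comm; *-distribˡ-sum)
open +-*-Solver using (solve; _:+_; _:*_; _:-_; _:=_; con)

private variable
  n m : ℕ

-- Order arithmetic and division in ℚ.

0≤+ : ∀ {p q} → 0ℚ ≤ p → 0ℚ ≤ q → 0ℚ ≤ p + q
0≤+ = +-mono-≤

*-monoˡ-≤ : ∀ {r p q} → 0ℚ ≤ r → p ≤ q → r * p ≤ r * q
*-monoˡ-≤ {r} 0≤r = *-monoˡ-≤-nonNeg r {{nonNegative 0≤r}}

0≤* : ∀ {p q} → 0ℚ ≤ p → 0ℚ ≤ q → 0ℚ ≤ p * q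
0≤* {p} {q} 0≤p 0≤q = subst (_≤ p * q) (*-zeroʳ p) (*-monoˡ-≤ 0≤p 0≤q)

≤⇒0≤- : ∀ {p q} → p ≤ q → 0ℚ ≤ q - p
≤⇒0≤- {p} {q} p≤q = subst (_≤ q - p) (+-inverseʳ p) (+-monoˡ-≤ (- p) p≤q)

1-≤1 : ∀ {p} → 0ℚ ≤ p → 1ℚ - p ≤ 1ℚ
1-≤1 0≤p = +-monoʳ-≤ 1ℚ (neg-antimono-≤ 0≤p)

convex-≤1 : ∀ {a p q} → 0ℚ ≤ a → a ≤ 1ℚ → p ≤ 1ℚ → q ≤ 1ℚ → (1ℚ - a) * p + a * q ≤ 1ℚ
convex-≤1 {a} 0≤a a≤1 p≤1 q≤1 = ≤-trans
  (+-mono-≤ (*-monoˡ-≤ (≤⇒0≤- a≤1) p≤1) (*-monoˡ-≤ 0≤a q≤1))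
  (≤-reflexive (solve 1 (λ a → (con 1ℚ :- a) :* con 1ℚ :+ a :* con 1ℚ := con 1ℚ) refl a))

-- Division by a total weight `t` that may be zero: `ρ` will be `1/ t`, or 0 if `t` is 0. In the
-- second case `0ℚ ≤ u` and `u ≤ t` force `u` to vanish, so one cancellation law covers both.
record PseudoInverse (t : ℚ) : Set where
  field
    ρ : ℚ
    0≤ρ : 0ℚ ≤ ρ
    ρt≤1 : ρ * t ≤ 1ℚ
    tρu≡u : ∀ {u} → 0ℚ ≤ u → u ≤ t → t * (ρ * u) ≡ u

pseudoInverse : ∀ {t} → 0ℚ ≤ t → PseudoInverse t
pseudoInverse {t} 0≤t with t ≤? 0ℚ
... | yes t≤0 = record
  { ρ = 0ℚ
  ; 0≤ρ = ≤-refl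
  ; ρt≤1 = subst (_≤ 1ℚ) (sym (*-zeroˡ t)) (nonNegative⁻¹ 1ℚ)
  ; tρu≡u = λ {u} 0≤u u≤t → trans
      (solve 2 (λ t u → t :* (con 0ℚ :* u) := con 0ℚ) refl t u)
      (≤-antisym 0≤u (≤-trans u≤t t≤0))
  }
... | no t≰0 = record
  { ρ = 1/ t
  ; 0≤ρ = <⇒≤ (positive⁻¹ (1/ t) {{1/pos⇒pos t}})
  ; ρt≤1 = ≤-reflexive (*-inverseˡ t)
  ; tρu≡u = λ {u} _ _ →
      trans (sym (*-assoc t (1/ t) u)) (trans (cong (_* u) (*-inverseʳ t)) (*-identityˡ u))
  }
  where instance
    t-pos = positive (≰⇒> t≰0)
    t-nonZero = pos⇒nonZero t

-- Finite sums and dot products.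

sumFin≡sum : (f : Fin n → ℚ) → sumFin f ≡ sum f
sumFin≡sum {zero}  f = refl
sumFin≡sum {suc n} f = cong (f zero +_) (sumFin≡sum (λ k → f (suc k)))

sumFin-cong : {f g : Fin n → ℚ} → (∀ k → f k ≡ g k) → sumFin f ≡ sumFin g
sumFin-cong {f = f} {g} f≡g = trans (sumFin≡sum f) (trans (sum-cong-≗ f≡g) (sym (sumFin≡sum g)))

sumFin-+ : (f g : Fin n → ℚ) → sumFin (λ k → f k + g k) ≡ sumFin f + sumFin g
sumFin-+ f g = trans (sumFin≡sum (λ k → f k + g k))
  (trans (∑-distrib-+ f g) (sym (cong₂ _+_ (sumFin≡sum f) (sumFin≡sum g))))

sumFin-*ˡ : ∀ c (f : Fin n → ℚ) → sumFin (λ k → c * f k) ≡ c * sumFin f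
sumFin-*ˡ c f = trans (sumFin≡sum (λ k → c * f k))
  (trans (sym (*-distribˡ-sum c f)) (cong (c *_) (sym (sumFin≡sum f))))

sumFin-affine : ∀ c (f g : Fin n → ℚ) → sumFin (λ k → c * f k + g k) ≡ c * sumFin f + sumFin g
sumFin-affine c f g = trans (sumFin-+ (λ k → c * f k) g) (cong (_+ sumFin g) (sumFin-*ˡ c f))

sumFin-comm : (f : Fin n → Fin m → ℚ) →
  sumFin (λ i → sumFin (f i)) ≡ sumFin (λ j → sumFin (λ i → f i j))
sumFin-comm f = trans (double f) (trans (∑-comm f) (sym (double (λ j i → f i j))))
  where
  double : ∀ {a b} (g : Fin a → Fin b → ℚ) → sumFin (λ i → sumFin (g i)) ≡ sum (λ i → sum (g i))
  double g = trans (sumFin≡sum (λ i → sumFin (g i))) (sum-cong-≗ (λ i → sumFin≡sum (g i)))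

sumFin-mono : {f g : Fin n → ℚ} → (∀ k → f k ≤ g k) → sumFin f ≤ sumFin g
sumFin-mono {zero}  f≤g = ≤-refl
sumFin-mono {suc n} f≤g = +-mono-≤ (f≤g zero) (sumFin-mono (λ k → f≤g (suc k)))

sumFin-0 : (f : Fin n → ℚ) → (∀ k → f k ≡ 0ℚ) → sumFin f ≡ 0ℚ
sumFin-0 {zero}  f f≡0 = refl
sumFin-0 {suc n} f f≡0 = cong₂ _+_ (f≡0 zero) (sumFin-0 (λ k → f (suc k)) (λ k → f≡0 (suc k)))

sumFin-nonNeg : {f : Fin n → ℚ} → (∀ k → 0ℚ ≤ f k) → 0ℚ ≤ sumFin f
sumFin-nonNeg {n} {f} 0≤f = subst (_≤ sumFin f) (sumFin-0 {n} (λ _ → 0ℚ) (λ _ → refl)) (sumFin-mono 0≤f)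

infixl 7 _·_
_·_ : (Fin n → ℚ) → (Fin n → ℚ) → ℚ
w · z = sumFin (λ k → w k * z k)

𝟙 : Fin n → ℚ
𝟙 _ = 1ℚ

complement : (Fin n → ℚ) → Fin n → ℚ
complement z k = 1ℚ - z k

·-𝟙 : (w : Fin n → ℚ) → w · 𝟙 ≡ sumFin w
·-𝟙 w = sumFin-cong (λ k → *-identityʳ (w k))

·-nonNeg : {w z : Fin n → ℚ} → (∀ k → 0ℚ ≤ w k) → (∀ k → 0ℚ ≤ z k) → 0ℚ ≤ w · z
·-nonNeg 0≤w 0≤z = sumFin-nonNeg (λ k → 0≤* (0≤w k) (0≤z k))

·-monoʳ : (w : Fin n → ℚ) {z z′ : Fin n → ℚ} → (∀ k → 0ℚ ≤ w k) → (∀ k → z k ≤ z′ k) → w · z ≤ w · z′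
·-monoʳ w 0≤w z≤z′ = sumFin-mono (λ k → *-monoˡ-≤ (0≤w k) (z≤z′ k))

·-zeroˡ : (w z : Fin n → ℚ) → (∀ k → w k ≡ 0ℚ) → w · z ≡ 0ℚ
·-zeroˡ w z w≡0 = sumFin-0 (λ k → w k * z k) (λ k → trans (cong (_* z k) (w≡0 k)) (*-zeroˡ (z k)))

·-combine : ∀ c (v w z : Fin n → ℚ) → (λ k → w k + c * v k) · z ≡ w · z + c * (v · z)
·-combine c v w z = trans
  (sumFin-cong (λ k → solve 4 (λ c v w z → (w :+ c :* v) :* z := c :* (v :* z) :+ w :* z) refl c (v k) (w k) (z k)))
  (trans (sumFin-affine c (λ k → v k * z k) (λ k → w k * z k)) (+-comm (c * (v · z)) (w · z)))

·-complement : (w z : Fin n → ℚ) → w · complement z ≡ w · 𝟙 - w · z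
·-complement w z = begin
  w · complement z                              ≡⟨ sumFin-cong (λ k → solve 2 (λ w z → w :* (con 1ℚ :- z) := con (- 1ℚ) :* (w :* z) :+ w :* con 1ℚ) refl (w k) (z k)) ⟩
  sumFin (λ k → - 1ℚ * (w k * z k) + w k * 1ℚ)  ≡⟨ sumFin-affine (- 1ℚ) (λ k → w k * z k) (λ k → w k * 1ℚ) ⟩
  - 1ℚ * (w · z) + w · 𝟙                        ≡⟨ solve 2 (λ a b → con (- 1ℚ) :* a :+ b := b :- a) refl (w · z) (w · 𝟙) ⟩
  w · 𝟙 - w · z                                 ∎
  where open ≡-Reasoning

-- Diagonally dominant linear systems with solutions in [0, 1].

-- Eliminating the unknown 0 keeps the coefficients nonnegative and the system diagonally dominant.
dominantSystem : (w : Fin m → Fin m → ℚ) (c d : Fin m → ℚ) →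
  (∀ a b → 0ℚ ≤ w a b) → (∀ a → 0ℚ ≤ c a) → (∀ a → c a + w a · 𝟙 ≤ d a) →
  Σ (Fin m → ℚ) λ r → (∀ a → 0ℚ ≤ r a) × (∀ a → r a ≤ 1ℚ) × (∀ a → d a * r a ≡ c a + w a · r)
dominantSystem {zero}  w c d 0≤w 0≤c dom = (λ ()) , (λ ()) , (λ ()) , (λ ())
dominantSystem {suc m} w c d 0≤w 0≤c dom = r , 0≤r , r≤1 , eq
  where
  w₀ : Fin m → ℚ
  w₀ b = w zero (suc b)

  -- The pivot: unknown 0 also occurs on the right of its own equation, with coefficient
  -- `w zero zero`. Dominance only yields `0ℚ ≤ t`, so the pivot may be zero.
  t : ℚ
  t = d zero - w zero zero

  rest : (Fin m → ℚ) → ℚ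
  rest z = c zero + w₀ · z

  rest-nonNeg : ∀ {z} → (∀ b → 0ℚ ≤ z b) → 0ℚ ≤ rest z
  rest-nonNeg 0≤z = 0≤+ (0≤c zero) (·-nonNeg (λ b → 0≤w zero (suc b)) 0≤z)

  rest-𝟙≤t : rest 𝟙 ≤ t
  rest-𝟙≤t = subst (_≤ t)
    (solve 3 (λ c w s → c :+ (w :* con 1ℚ :+ s) :- w := c :+ s) refl (c zero) (w zero zero) (w₀ · 𝟙))
    (+-monoˡ-≤ (- w zero zero) (dom zero))

  0≤𝟙 : ∀ (b : Fin m) → 0ℚ ≤ 1ℚ
  0≤𝟙 _ = nonNegative⁻¹ 1ℚ

  0≤t : 0ℚ ≤ t
  0≤t = ≤-trans (rest-nonNeg 0≤𝟙) rest-𝟙≤t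

  open PseudoInverse (pseudoInverse 0≤t)

  -- The system left after substituting `ρ * rest z` for unknown 0.
  w′ : Fin m → Fin m → ℚ
  w′ a b = w (suc a) (suc b) + w (suc a) zero * ρ * w₀ b

  c′ : Fin m → ℚ
  c′ a = c (suc a) + w (suc a) zero * (ρ * c zero)

  -- Needed twice: at `𝟙` it gives dominance of the reduced system, at `r′` it carries the solution
  -- back.
  substitute : ∀ a z → c′ a + w′ a · z ≡
    c (suc a) + (w (suc a) zero * (ρ * rest z) + (λ b → w (suc a) (suc b)) · z)
  substitute a z = trans
    (cong (c′ a +_) (·-combine (w (suc a) zero * ρ) w₀ (λ b → w (suc a) (suc b)) z))
    (solve 6 (λ c k ρ c₀ s s₀ → c :+ k :* (ρ :* c₀) :+ (s :+ k :* ρ :* s₀) := c :+ (k :* (ρ :* (c₀ :+ s₀)) :+ s))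
      refl (c (suc a)) (w (suc a) zero) ρ (c zero) ((λ b → w (suc a) (suc b)) · z) (w₀ · z))

  ρrest≤1 : ∀ {z} → (∀ b → z b ≤ 1ℚ) → ρ * rest z ≤ 1ℚ
  ρrest≤1 z≤1 = ≤-trans
    (*-monoˡ-≤ 0≤ρ (≤-trans (+-monoʳ-≤ (c zero) (·-monoʳ w₀ (λ b → 0≤w zero (suc b)) z≤1)) rest-𝟙≤t))
    ρt≤1

  dom′ : ∀ a → c′ a + w′ a · 𝟙 ≤ d (suc a)
  -- At `𝟙` the eliminated unknown takes a value of at most 1, so the reduced row sum does not
  -- exceed the original one.
  dom′ a = ≤-trans (≤-reflexive (substitute a 𝟙)) (≤-trans
    (+-monoʳ-≤ (c (suc a)) (+-monoˡ-≤ _ (*-monoˡ-≤ (0≤w (suc a) zero) (ρrest≤1 (λ _ → ≤-refl)))))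
    (dom (suc a)))

  ih = dominantSystem w′ c′ (λ a → d (suc a))
    (λ a b → 0≤+ (0≤w _ _) (0≤* (0≤* (0≤w _ _) 0≤ρ) (0≤w _ _)))
    (λ a → 0≤+ (0≤c _) (0≤* (0≤w _ _) (0≤* 0≤ρ (0≤c _))))
    dom′

  r′ : Fin m → ℚ
  r′ = proj₁ ih

  0≤r′ : ∀ b → 0ℚ ≤ r′ b
  0≤r′ = proj₁ (proj₂ ih)

  r′≤1 : ∀ b → r′ b ≤ 1ℚ
  r′≤1 = proj₁ (proj₂ (proj₂ ih))

  r : Fin (suc m) → ℚ
  r zero    = ρ * rest r′
  r (suc b) = r′ b

  0≤r : ∀ a → 0ℚ ≤ r a
  0≤r zero    = 0≤* 0≤ρ (rest-nonNeg 0≤r′)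
  0≤r (suc b) = 0≤r′ b

  r≤1 : ∀ a → r a ≤ 1ℚ
  r≤1 zero    = ρrest≤1 r′≤1
  r≤1 (suc b) = r′≤1 b

  eq : ∀ a → d a * r a ≡ c a + w a · r
  eq zero = begin
    d zero * r zero                       ≡⟨ solve 3 (λ d w r → d :* r := w :* r :+ (d :- w) :* r) refl (d zero) (w zero zero) (r zero) ⟩
    -- Since `r′` is at most 1, dominance bounds `rest r′` by the pivot; if the pivot is zero, both
    -- sides vanish.
    w zero zero * r zero + t * r zero     ≡⟨ cong (w zero zero * r zero +_) (tρu≡u (rest-nonNeg 0≤r′)
                                               (≤-trans (+-monoʳ-≤ (c zero) (·-monoʳ w₀ (λ b → 0≤w zero (suc b)) r′≤1)) rest-𝟙≤t)) ⟩
    w zero zero * r zero + rest r′        ≡⟨ solve 3 (λ k c s → k :+ (c :+ s) := c :+ (k :+ s)) refl (w zero zero * r zero) (c zero) (w₀ · r′) ⟩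
    c zero + w zero · r                   ∎
    where open ≡-Reasoning
  eq (suc a) = trans (proj₂ (proj₂ (proj₂ ih)) a) (substitute a r′)

-- Harmonic potentials on items and bins.

-- Harmonicity of `q` and `r` on the bipartite graph of items and bins, where items average with
-- weights `y` and bins with weights `x`. Each equation is multiplied by the total weight, which
-- avoids division at vertices of weight zero.
record Balanced (x : Fin m → Fin n → ℚ) (y : Fin n → Fin m → ℚ) (q : Fin n → ℚ) (r : Fin m → ℚ) : Set where
  field
    0≤q : ∀ i → 0ℚ ≤ q i
    q≤1 : ∀ i → q i ≤ 1ℚ
    0≤r : ∀ j → 0ℚ ≤ r j
    r≤1 : ∀ j → r j ≤ 1ℚ
    y-balance : ∀ i → y i · 𝟙 * q i ≡ y i · r
    x-balance : ∀ j → x j · 𝟙 * r j ≡ x j · q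

-- The vector e prescribes q on the items that y does not use.
balancedPotential : (x : Fin m → Fin n → ℚ) (y : Fin n → Fin m → ℚ) (e : Fin n → ℚ) →
  (∀ j i → 0ℚ ≤ x j i) → (∀ i j → 0ℚ ≤ y i j) → (∀ i → 0ℚ ≤ e i) → (∀ i → e i ≤ 1ℚ) →
  (∀ i → e i ≡ 0ℚ ⊎ (∀ j → y i j ≡ 0ℚ)) →
  Σ (Fin n → ℚ) λ q → Σ (Fin m → ℚ) λ r →
    Balanced x y q r × (∀ i → (∀ j → y i j ≡ 0ℚ) → q i ≡ e i)
balancedPotential {m} {n} x y e 0≤x 0≤y 0≤e e≤1 e≡0⊎y≡0 = average r , r , balanced , λ i → average-boundary i r
  where
  inverse : ∀ i → PseudoInverse (y i · 𝟙)
  inverse i = pseudoInverse (·-nonNeg (0≤y i) (λ _ → nonNegative⁻¹ 1ℚ))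

  open module Inverse i = PseudoInverse (inverse i)

  -- By `e≡0⊎y≡0`, at least one of the two summands is zero at every item: either the prescribed
  -- value or the average over bins remains.
  average : (Fin m → ℚ) → Fin n → ℚ
  average z i = e i + ρ i * (y i · z)

  average-boundary : ∀ i z → (∀ j → y i j ≡ 0ℚ) → average z i ≡ e i
  average-boundary i z y≡0 = trans
    (cong (λ a → e i + ρ i * a) (·-zeroˡ (y i) z y≡0))
    (solve 2 (λ e ρ → e :+ ρ :* con 0ℚ := e) refl (e i) (ρ i))

  average-nonNeg : ∀ {z} → (∀ j → 0ℚ ≤ z j) → ∀ i → 0ℚ ≤ average z i
  average-nonNeg 0≤z i = 0≤+ (0≤e i) (0≤* (0≤ρ i) (·-nonNeg (0≤y i) 0≤z))

  average≤1 : ∀ {z} → (∀ j → z j ≤ 1ℚ) → ∀ i → average z i ≤ 1ℚ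
  average≤1 {z} z≤1 i with e≡0⊎y≡0 i
  ... | inj₁ e≡0 = ≤-trans
    (≤-reflexive (trans (cong (_+ ρ i * (y i · z)) e≡0) (+-identityˡ _)))
    (≤-trans (*-monoˡ-≤ (0≤ρ i) (·-monoʳ (y i) (0≤y i) z≤1)) (ρt≤1 i))
  ... | inj₂ y≡0 = ≤-trans (≤-reflexive (average-boundary i z y≡0)) (e≤1 i)

  average-balance : ∀ {z} → (∀ j → 0ℚ ≤ z j) → (∀ j → z j ≤ 1ℚ) → ∀ i → y i · 𝟙 * average z i ≡ y i · z
  average-balance {z} 0≤z z≤1 i with e≡0⊎y≡0 i
  ... | inj₁ e≡0 = trans
    (cong (y i · 𝟙 *_) (trans (cong (_+ ρ i * (y i · z)) e≡0) (+-identityˡ _)))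
    (tρu≡u i (·-nonNeg (0≤y i) 0≤z) (·-monoʳ (y i) (0≤y i) z≤1))
  ... | inj₂ y≡0 = trans
    (trans (cong (_* average z i) (·-zeroˡ (y i) 𝟙 y≡0)) (*-zeroˡ (average z i)))
    (sym (·-zeroˡ (y i) z y≡0))

  -- Two-step weights from bin `j` through an item to bin `k`: substituting `average` for `q` leaves
  -- a system in `r` alone.
  w : Fin m → Fin m → ℚ
  w j k = sumFin (λ i → x j i * ρ i * y i k)

  x·average : ∀ j z → x j · e + w j · z ≡ x j · average z
  x·average j z = begin
    x j · e + w j · z
      ≡⟨ cong (x j · e +_) (sumFin-cong (λ k → trans (*-comm (w j k) (z k)) (sym (sumFin-*ˡ (z k) (λ i → x j i * ρ i * y i k))))) ⟩
    x j · e + sumFin (λ k → sumFin (λ i → z k * (x j i * ρ i * y i k)))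
      ≡⟨ cong (x j · e +_) (sumFin-comm (λ k i → z k * (x j i * ρ i * y i k))) ⟩
    x j · e + sumFin (λ i → sumFin (λ k → z k * (x j i * ρ i * y i k)))
      ≡⟨ cong (x j · e +_) (sumFin-cong (λ i → trans
           (sumFin-cong (λ k → solve 4 (λ z x ρ y → z :* (x :* ρ :* y) := x :* ρ :* (y :* z)) refl (z k) (x j i) (ρ i) (y i k)))
           (sumFin-*ˡ (x j i * ρ i) (λ k → y i k * z k)))) ⟩
    x j · e + sumFin (λ i → x j i * ρ i * (y i · z))
      ≡⟨ sym (sumFin-+ (λ i → x j i * e i) (λ i → x j i * ρ i * (y i · z))) ⟩
    sumFin (λ i → x j i * e i + x j i * ρ i * (y i · z))
      ≡⟨ sumFin-cong (λ i → solve 4 (λ x e ρ s → x :* e :+ x :* ρ :* s := x :* (e :+ ρ :* s)) refl (x j i) (e i) (ρ i) (y i · z)) ⟩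
    x j · average z ∎
    where open ≡-Reasoning

  solution = dominantSystem w (λ j → x j · e) (λ j → x j · 𝟙)
    (λ j k → sumFin-nonNeg (λ i → 0≤* (0≤* (0≤x j i) (0≤ρ i)) (0≤y i k)))
    (λ j → ·-nonNeg (0≤x j) 0≤e)
    -- Dominance holds because the averages of `𝟙` are at most 1.
    (λ j → ≤-trans (≤-reflexive (x·average j 𝟙)) (·-monoʳ (x j) (0≤x j) (average≤1 (λ _ → ≤-refl))))

  r : Fin m → ℚ
  r = proj₁ solution

  0≤r : ∀ j → 0ℚ ≤ r j
  0≤r = proj₁ (proj₂ solution)

  r≤1 : ∀ j → r j ≤ 1ℚ
  r≤1 = proj₁ (proj₂ (proj₂ solution))

  balanced : Balanced x y (average r) r
  balanced = record
    { 0≤q = average-nonNeg 0≤r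
    ; q≤1 = average≤1 r≤1
    ; 0≤r = 0≤r
    ; r≤1 = r≤1
    ; y-balance = average-balance 0≤r r≤1
    ; x-balance = λ j → trans (proj₂ (proj₂ (proj₂ solution)) j) (x·average j r)
    }

-- Averaging fixes constants: both sides of the balance equation are subtracted from the total
-- weight `w · 𝟙`.
·-complement-balance : (w z : Fin n → ℚ) (a : ℚ) → w · 𝟙 * a ≡ w · z → w · 𝟙 * (1ℚ - a) ≡ w · complement z
·-complement-balance w z a bal = begin
  w · 𝟙 * (1ℚ - a)     ≡⟨ solve 2 (λ s a → s :* (con 1ℚ :- a) := s :- s :* a) refl (w · 𝟙) a ⟩
  w · 𝟙 - w · 𝟙 * a    ≡⟨ cong (λ b → w · 𝟙 - b) bal ⟩
  w · 𝟙 - w · z        ≡⟨ sym (·-complement w z) ⟩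
  w · complement z     ∎
  where open ≡-Reasoning

-- This symmetry exchanges the roles of `u` and `v`, so one feasibility proof serves both.
Balanced-complement : {x : Fin m → Fin n → ℚ} {y : Fin n → Fin m → ℚ} {q : Fin n → ℚ} {r : Fin m → ℚ} →
  Balanced x y q r → Balanced x y (complement q) (complement r)
Balanced-complement {x = x} {y} {q} {r} bal = record
  { 0≤q = λ i → ≤⇒0≤- (q≤1 i)
  ; q≤1 = λ i → 1-≤1 (0≤q i)
  ; 0≤r = λ j → ≤⇒0≤- (r≤1 j)
  ; r≤1 = λ j → 1-≤1 (0≤r j)
  ; y-balance = λ i → ·-complement-balance (y i) r (q i) (y-balance i)
  ; x-balance = λ j → ·-complement-balance (x j) q (r j) (x-balance j)
  }
  where open Balanced bal

-- Mixing two assignments by potentials.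

load : (Fin n → ℚ) → Assignment n m → Fin m → Fin n → ℚ
load s x j i = x i j * s i

-- This is `u`; the complements of `q` and `r` in the same formula give `v`.
mix : (Fin n → ℚ) → (Fin m → ℚ) → Assignment n m → Assignment n m → Assignment n m
mix q r x y i j = (1ℚ - q i) * x i j + y i j * r j

-- In a row, `y-balance` trades `r` for `q i`; in a column, `x-balance` trades `q` for `r j`. Each
-- sum thus becomes a convex combination of the sums of `x` and `y`. Outside `S` the `x` part
-- vanishes by the support of `x` or by `q i` being 1, the `y` part by the support of `y`.
mix-feasible : {s : Fin n → ℚ} {A B S : Subset n} {x y : Assignment n m} {q : Fin n → ℚ} {r : Fin m → ℚ} →
  Feasible s A x → Feasible s B y → Balanced (load s x) y q r →
  (∀ i → i ∉ S → i ∉ A ⊎ q i ≡ 1ℚ) → (∀ i → i ∉ S → i ∉ B) →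
  Feasible s S (mix q r x y)
mix-feasible {s = s} {A} {B} {S} {x} {y} {q} {r} (xrow , xcol , xsupp , 0≤x) (yrow , ycol , ysupp , 0≤y) bal offA offB =
  row , col , supp , nonNeg
  where
  open Balanced bal
  open ≡-Reasoning

  row : ∀ i → sumFin (mix q r x y i) ≤ 1ℚ
  row i = ≤-trans (≤-reflexive (begin
    sumFin (mix q r x y i)                              ≡⟨ sumFin-affine (1ℚ - q i) (x i) (λ j → y i j * r j) ⟩
    (1ℚ - q i) * sumFin (x i) + y i · r                 ≡⟨ cong ((1ℚ - q i) * sumFin (x i) +_) (sym (y-balance i)) ⟩
    (1ℚ - q i) * sumFin (x i) + y i · 𝟙 * q i           ≡⟨ cong ((1ℚ - q i) * sumFin (x i) +_) (trans (*-comm (y i · 𝟙) (q i)) (cong (q i *_) (·-𝟙 (y i)))) ⟩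
    (1ℚ - q i) * sumFin (x i) + q i * sumFin (y i)      ∎))
    (convex-≤1 (0≤q i) (q≤1 i) (xrow i) (yrow i))

  col : ∀ j → sumFin (λ i → mix q r x y i j * s i) ≤ 1ℚ
  col j = ≤-trans (≤-reflexive (begin
    sumFin (λ i → mix q r x y i j * s i)
      ≡⟨ sumFin-cong (λ i → solve 5 (λ q x y r s → ((con 1ℚ :- q) :* x :+ y :* r) :* s := r :* (y :* s) :+ x :* s :* (con 1ℚ :- q))
           refl (q i) (x i j) (y i j) (r j) (s i)) ⟩
    sumFin (λ i → r j * load s y j i + load s x j i * (1ℚ - q i))
      ≡⟨ sumFin-affine (r j) (load s y j) (λ i → load s x j i * (1ℚ - q i)) ⟩
    r j * sumFin (load s y j) + load s x j · complement q
      ≡⟨ cong (r j * sumFin (load s y j) +_) (sym (·-complement-balance (load s x j) q (r j) (x-balance j))) ⟩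
    r j * sumFin (load s y j) + load s x j · 𝟙 * (1ℚ - r j)
      ≡⟨ cong (λ a → r j * sumFin (load s y j) + a * (1ℚ - r j)) (·-𝟙 (load s x j)) ⟩
    r j * sumFin (load s y j) + sumFin (load s x j) * (1ℚ - r j)
      ≡⟨ solve 3 (λ r a b → r :* a :+ b :* (con 1ℚ :- r) := (con 1ℚ :- r) :* b :+ r :* a) refl (r j) (sumFin (load s y j)) (sumFin (load s x j)) ⟩
    (1ℚ - r j) * sumFin (load s x j) + r j * sumFin (load s y j) ∎))
    (convex-≤1 (0≤r j) (r≤1 j) (xcol j) (ycol j))

  supp : ∀ i j → i ∉ S → mix q r x y i j ≡ 0ℚ
  supp i j i∉S = cong₂ _+_ xpart ypart
    where
    xpart : (1ℚ - q i) * x i j ≡ 0ℚ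
    xpart = [ (λ i∉A → trans (cong ((1ℚ - q i) *_) (xsupp i j i∉A)) (*-zeroʳ (1ℚ - q i)))
            , (λ q≡1 → trans (cong (λ a → (1ℚ - a) * x i j) q≡1) (*-zeroˡ (x i j))) ]′ (offA i i∉S)

    ypart : y i j * r j ≡ 0ℚ
    ypart = trans (cong (_* r j) (ysupp i j (offB i i∉S))) (*-zeroˡ (r j))

  nonNeg : ∀ i j → 0ℚ ≤ mix q r x y i j
  nonNeg i j = 0≤+ (0≤* (≤⇒0≤- (q≤1 i)) (0≤x i j)) (0≤* (0≤y i j) (0≤r j))

value-+ : (p x y : Assignment n m) → value p (λ i j → x i j + y i j) ≡ value p x + value p y
value-+ p x y = trans
  (sumFin-cong (λ i → trans (sumFin-cong (λ j → *-distribʳ-+ (p i j) (x i j) (y i j))) 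
    (sumFin-+ (λ j → x i j * p i j) (λ j → y i j * p i j))))
  (sumFin-+ (λ i → sumFin (λ j → x i j * p i j)) (λ i → sumFin (λ j → y i j * p i j)))

-- The two mixtures add up to `x + y` in every entry, so redistribution preserves total profit.
value-mix : (p x y : Assignment n m) (q : Fin n → ℚ) (r : Fin m → ℚ) →
  value p (mix q r x y) + value p (mix (complement q) (complement r) x y) ≡ value p x + value p y
value-mix p x y q r = begin
  value p (mix q r x y) + value p (mix (complement q) (complement r) x y)
    ≡⟨ sym (value-+ p (mix q r x y) (mix (complement q) (complement r) x y)) ⟩
  value p (λ i j → mix q r x y i j + mix (complement q) (complement r) x y i j)
    ≡⟨ sumFin-cong (λ i → sumFin-cong (λ j → cong (_* p i j) (solve 4
         (λ q r x y → (con 1ℚ :- q) :* x :+ y :* r :+ ((con 1ℚ :- (con 1ℚ :- q)) :* x :+ y :* (con 1ℚ :- r)) := x :+ y)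
         refl (q i) (r j) (x i j) (y i j)))) ⟩
  value p (λ i j → x i j + y i j)
    ≡⟨ value-+ p x y ⟩
  value p x + value p y ∎
  where open ≡-Reasoning

-- Redistributing the optima of `S ∪ T` and `S ∩ T` to `S` and `T`.

theorem1 : (n m : ℕ) (s : Fin n → ℚ) (p : Fin n → Fin m → ℚ) →
    ((i : Fin n) → 0ℚ < s i) →
    ((i : Fin n) → (j : Fin m) → 0ℚ ≤ p i j) →
    (S T : Subset n) (φS φT φS∪T φS∩T : ℚ) →
    IsOptimalValue s p S φS →
    IsOptimalValue s p T φT →
    IsOptimalValue s p (S ∪ T) φS∪T →
    IsOptimalValue s p (S ∩ T) φS∩T →
    φS∪T + φS∩T ≤ φS + φT
theorem1 n m s p 0<s 0≤p S T φS φT φS∪T φS∩T (_ , maxS) (_ , maxT)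
  ((x , x-feas , x-val) , _) ((y , y-feas , y-val) , _) =
  conclude (balancedPotential (load s x) y e
    (λ j i → 0≤* (proj₂ (proj₂ (proj₂ x-feas)) i j) (<⇒≤ (0<s i)))
    (proj₂ (proj₂ (proj₂ y-feas))) 0≤e e≤1 e≡0⊎y≡0)
  where
  -- The indicator of the complement of `S`. Since `y` vanishes outside `S ∩ T`, it forces `q` to be
  -- 1 outside `S` and 0 on the items of `S` outside `T`; on `S ∩ T` it is 0, as `e≡0⊎y≡0` demands
  -- wherever `y` may be nonzero.
  e : Fin n → ℚ
  e i with i ∈? S
  ... | yes _ = 0ℚ
  ... | no  _ = 1ℚ

  e-in : ∀ i → i ∈ S → e i ≡ 0ℚ
  e-in i i∈S with i ∈? S
  ... | yes _   = refl
  ... | no  i∉S = contradiction i∈S i∉S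

  e-out : ∀ i → i ∉ S → e i ≡ 1ℚ
  e-out i i∉S with i ∈? S
  ... | yes i∈S = contradiction i∈S i∉S
  ... | no  _   = refl

  0≤e : ∀ i → 0ℚ ≤ e i
  0≤e i with i ∈? S
  ... | yes _ = ≤-refl
  ... | no  _ = nonNegative⁻¹ 1ℚ

  e≤1 : ∀ i → e i ≤ 1ℚ
  e≤1 i with i ∈? S
  ... | yes _ = nonNegative⁻¹ 1ℚ
  ... | no  _ = ≤-refl

  ∉S⇒∉∩ : ∀ i → i ∉ S → i ∉ S ∩ T
  ∉S⇒∉∩ i i∉S i∈∩ = i∉S (proj₁ (x∈p∩q⁻ S T i∈∩))

  ∉T⇒∉∩ : ∀ i → i ∉ T → i ∉ S ∩ T
  ∉T⇒∉∩ i i∉T i∈∩ = i∉T (proj₂ (x∈p∩q⁻ S T i∈∩))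

  y≡0 : ∀ i → i ∉ S ∩ T → ∀ j → y i j ≡ 0ℚ
  y≡0 i i∉∩ j = proj₁ (proj₂ (proj₂ y-feas)) i j i∉∩

  e≡0⊎y≡0 : ∀ i → e i ≡ 0ℚ ⊎ (∀ j → y i j ≡ 0ℚ)
  e≡0⊎y≡0 i with i ∈? S
  ... | yes _   = inj₁ refl
  ... | no  i∉S = inj₂ (y≡0 i (∉S⇒∉∩ i i∉S))

  conclude : (Σ (Fin n → ℚ) λ q → Σ (Fin m → ℚ) λ r →
    Balanced (load s x) y q r × (∀ i → (∀ j → y i j ≡ 0ℚ) → q i ≡ e i)) →
    φS∪T + φS∩T ≤ φS + φT
  conclude (q , r , balanced , q≡e) =
    subst₂ (λ a b → a + b ≤ φS + φT) x-val y-val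
      (≤-trans (≤-reflexive (sym (value-mix p x y q r)))
        (+-mono-≤
          (maxS _ (mix-feasible x-feas y-feas balanced (λ i i∉S → inj₂ (q≡1 i i∉S)) ∉S⇒∉∩))
          (maxT _ (mix-feasible x-feas y-feas (Balanced-complement balanced) offT ∉T⇒∉∩))))
    where
    q≡1 : ∀ i → i ∉ S → q i ≡ 1ℚ
    q≡1 i i∉S = trans (q≡e i (y≡0 i (∉S⇒∉∩ i i∉S))) (e-out i i∉S)

    offT : ∀ i → i ∉ T → i ∉ S ∪ T ⊎ complement q i ≡ 1ℚ
    offT i i∉T with i ∈? S
    -- In `S` but not in `T`, `q i` is 0 and `v` receives nothing from `x`; outside both sets `x`
    -- itself vanishes.
    ... | yes i∈S = inj₂ (cong (λ a → 1ℚ - a) (trans (q≡e i (y≡0 i (∉T⇒∉∩ i i∉T))) (e-in i i∈S)))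
    ... | no  i∉S = inj₁ (λ i∈∪ → [ i∉S , i∉T ]′ (x∈p∪q⁻ S T i∈∪))
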